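{- Let $x\geq 3$ be an integer, let $a,b,c\geq 0$ be integers, set $v=a+b+c+1$, and let $L=\{1^a,x^b,(x+1)^c\}$ be an admissible list. Then there exists a Hamiltonian path $H$ of $K_v$ with $\ell(H)=L$ in each of the following cases: (1) $x$ is odd and $a\geq \min\{3x-3,\, b+2x-3\}$; (2) $x$ is odd, $a\geq 2x-2$ and $c\geq \frac{4}{3}b$; (3) $x$ is even and $a\geq \min\{3x-1,\, c+2x-1\}$; (4) $x$ is even, $a\geq 2x-1$ and $b\geq c$.
   Context: $K_v$ is the complete graph on vertex set $\{0,1,\ldots,v-1\}$. The length of an edge $[x,y]$ is $\ell(x,y)=\min(|x-y|,\,v-|x-y|)$, and for a subgraph $H$, $\ell(H)$ is the list (multiset) of lengths of its edges. The notation $\{1^{a_1},2^{a_2},\ldots,t^{a_t}\}$ denotes the list (multiset) containing $a_i$ copies of $i$. A list $L$ of $v-1$ positive integers not exceeding $\lfloor v/2\rfloor$ is called admissible if for every divisor $d$ of $v$, the number of elements of $L$ (counted with multiplicity) that are multiples of $d$ is at most $v-d$. -}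

module Defs where

open import Data.Nat.Base using (ℕ; zero; suc; _+_; _*_; _∸_; _≤_; _⊓_; ∣_-_∣; _/_)
open import Data.Nat.Divisibility using (_∣_; _∣?_)
open import Data.List.Base using (List; []; _∷_; length; filter; replicate; _++_; upTo)
open import Data.List.Relation.Unary.All using (All)
open import Data.List.Relation.Binary.Permutation.Propositional using (_↭_)
open import Data.Product using (_×_; Σ)

edgeLength : ℕ → ℕ → ℕ → ℕ
edgeLength v x y = ∣ x - y ∣ ⊓ (v ∸ ∣ x - y ∣)

pathLengths : ℕ → List ℕ → List ℕ
pathLengths v []           = []
pathLengths v (x ∷ [])     = []
pathLengths v (x ∷ y ∷ xs) = edgeLength v x y ∷ pathLengths v (y ∷ xs)

-- a Hamiltonian path of K_v, given as its sequence of vertices: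
-- a permutation of 0,1,…,v-1 (consecutive vertices are adjacent, K_v complete)
IsHamiltonianPath : ℕ → List ℕ → Set
IsHamiltonianPath v p = p ↭ upTo v

countMultiples : ℕ → List ℕ → ℕ
countMultiples d L = length (filter (d ∣?_) L)

Admissible : ℕ → List ℕ → Set
Admissible v L =
  (length L ≡′ v ∸ 1) ×
  All (λ k → (1 ≤ k) × (k ≤ v / 2)) L ×
  ((d : ℕ) → d ∣ v → countMultiples d L ≤ v ∸ d)
  where
  open import Relation.Binary.PropositionalEquality using () renaming (_≡_ to _≡′_)

theList : ℕ → ℕ → ℕ → ℕ → List ℕ
theList x a b c = replicate a 1 ++ replicate b x ++ replicate c (suc x)

HasHamPathWith : ℕ → List ℕ → Set
HasHamPathWith v L = Σ (List ℕ) (λ p → IsHamiltonianPath v p × (pathLengths v p ↭ L))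

IsOdd : ℕ → Set
IsOdd x = x % 2 ≡ 1
  where open import Relation.Binary.PropositionalEquality using (_≡_)
        open import Data.Nat.Base using (_%_)

IsEven : ℕ → Set
IsEven x = x % 2 ≡ 0
  where open import Relation.Binary.PropositionalEquality using (_≡_)
        open import Data.Nat.Base using (_%_)

{-# OPTIONS --safe #-}
module Submission where

open import Defs
open import Data.Nat.Base using (ℕ; zero; suc; _+_; _*_; _∸_; _≤_; _<_; _⊓_; _/_; _%_; ∣_-_∣; z≤n; s≤s)
open import Data.Nat.DivMod using (m≡m%n+[m/n]*n; m%n<n; m/n*n≤m; m*n%n≡0; [m+kn]%n≡m%n)
open import Data.Nat.Tactic.RingSolver using (solve-∀)
open import Data.Nat.Properties
open import Data.List.Base using (List; []; _∷_; _++_; map; length; replicate; downFrom)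
open import Data.List.Properties using (++-assoc; ++-identityʳ; map-id; length-downFrom; reverse-upTo)
open import Data.List.Relation.Unary.All as All using (All; []; _∷_)
open import Data.List.Relation.Binary.Permutation.Propositional
  using (_↭_; ↭-refl; ↭-sym; ↭-trans; ↭-reflexive; prep; swap)
open import Data.List.Relation.Binary.Permutation.Propositional.Properties
  using (++⁺; ++⁺ˡ; ++⁺ʳ; shift; shifts; drop-∷; map⁺; ∷↭∷ʳ; All-resp-↭; ↭-length; ↭-reverse)
open import Data.Sum using (_⊎_; inj₁; inj₂; [_,_]′)
open import Data.Product using (_×_; _,_; ∃; proj₂)
open import Data.Unit using (⊤; tt)
open import Function using (_∘_; id)
open import Relation.Nullary using (contradiction)
open import Relation.Binary.PropositionalEquality
  using (_≡_; _≢_; refl; sym; trans; cong; cong₂; subst)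

-- All lengths in the list are at most v/2, so it suffices to realize it by differences |y - z|.
-- Call a path on 0, …, n with 0 as an end vertex rooted, and perfect if n is its other end vertex;
-- a rooted path can be stacked on a perfect one by identifying its 0 with n.
--
-- The basic move on a path covering 0, …, v-1 is a lift: if y and y+1 are adjacent and v = y + l,
-- replacing y, y+1 by y, v, v+1, y+1 adds two edges of length l and creates the adjacent pair
-- v, v+1. When the top l vertices are l/2 such pairs ("dominoes"), lifting continues forever; this
-- absorbs any number of edges of the even one among x and x+1, starting from 0, 1, … or from a fold
-- 0, l, l-1, …, 1 according to parity. Edges of the odd length o are written as q o + r with r < o.
-- The remainder r needs only finitely many lifts. The multiple q o is supplied either by a perfect
-- path {1^(o-1), o^(q o)}, costing o - 1 ones, which gives cases (1) and (3), or by q copies of the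
-- perfect zigzag {x^x, (x+1)^(x+1)}, costing no ones but as many edges of the other kind, which is
-- where the inequalities between b and c in cases (2) and (4) come from. For even x the remainder is
-- realized separately and glued below. For odd x that would cost one 1 too many, and the two
-- lengths are lifted on top of the same path instead.

-- Paths on 0, ..., v-1 measured by differences

gap : ℕ → List ℕ → List ℕ
gap y []      = []
gap y (z ∷ _) = ∣ y - z ∣ ∷ []

steps : List ℕ → List ℕ
steps []      = []
steps (y ∷ p) = gap y p ++ steps p

-- `downFrom (suc v)` computes to `v ∷ downFrom v`, so adding a new top vertex is a single `prep`.
record IsLinear (v : ℕ) (L p : List ℕ) : Set where
  constructor linear
  field
    covers  : p ↭ downFrom v
    lengths : steps p ↭ L

open IsLinear

-- Neighbours on a path and insertion between them

data Head (n : ℕ) : List ℕ → Set where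
  first : ∀ {p} → Head n (n ∷ p)

data End (n : ℕ) : List ℕ → Set where
  last  : End n (n ∷ [])
  there : ∀ {w p} → End n p → End n (w ∷ p)

data Adj (y z : ℕ) : List ℕ → Set where
  fwd   : ∀ {p} → Adj y z (y ∷ z ∷ p)
  bwd   : ∀ {p} → Adj y z (z ∷ y ∷ p)
  there : ∀ {w p} → Adj y z p → Adj y z (w ∷ p)

Domino : ℕ → List ℕ → Set
Domino y = Adj y (suc y)

adj-map : ∀ (f : ℕ → ℕ) {y z p} → Adj y z p → Adj (f y) (f z) (map f p)
adj-map f fwd       = fwd
adj-map f bwd       = bwd
adj-map f (there a) = there (adj-map f a)

adj-++ : ∀ {y z p} q → Adj y z p → Adj y z (p ++ q)
adj-++ q fwd       = fwd
adj-++ q bwd       = bwd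
adj-++ q (there a) = there (adj-++ q a)

insert : ∀ {y z p} → Adj y z p → ℕ → ℕ → List ℕ
insert {y} {z} (fwd {p})     u w = y ∷ u ∷ w ∷ z ∷ p
insert {y} {z} (bwd {p})     u w = z ∷ w ∷ u ∷ y ∷ p
insert         (there {v} a) u w = v ∷ insert a u w

module _ {y z : ℕ} (u w : ℕ) where

  insert-↭ : ∀ {p} (a : Adj y z p) → insert a u w ↭ u ∷ w ∷ p
  insert-↭ fwd = ↭-trans (swap y u ↭-refl) (prep u (swap y w ↭-refl))
  insert-↭ bwd = ↭-trans (prep z (swap w u ↭-refl))
                  (↭-trans (swap z u ↭-refl) (prep u (swap z w ↭-refl)))
  insert-↭ (there {v} a) = ↭-trans (prep v (insert-↭ a))
                  (↭-trans (swap v u ↭-refl) (prep u (swap v w ↭-refl)))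

  insert-gap : ∀ {p} (a : Adj y z p) v → gap v (insert a u w) ≡ gap v p
  insert-gap fwd       v = refl
  insert-gap bwd       v = refl
  insert-gap (there a) v = refl

  insert-steps : ∀ {p l} (a : Adj y z p) →
    ∣ y - u ∣ ≡ l → ∣ u - w ∣ ≡ ∣ y - z ∣ → ∣ w - z ∣ ≡ l →
    steps (insert a u w) ↭ l ∷ l ∷ steps p
  insert-steps {l = l} (fwd {p}) yu uw wz
    rewrite yu | uw | wz = prep l (swap _ l ↭-refl)
  insert-steps {l = l} (bwd {p}) yu uw wz
    rewrite ∣-∣-comm z w | wz | ∣-∣-comm w u | uw | ∣-∣-comm u y | yu | ∣-∣-comm z y
    = prep l (swap _ l ↭-refl)
  insert-steps {l = l} (there {v} {p} a) yu uw wz rewrite insert-gap a v =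
    ↭-trans (++⁺ˡ (gap v p) (insert-steps a yu uw wz))
      (↭-trans (shift l (gap v p) _) (prep l (shift l (gap v p) _)))

  insert-new : ∀ {p} (a : Adj y z p) → Adj u w (insert a u w)
  insert-new fwd       = there fwd
  insert-new bwd       = there bwd
  insert-new (there a) = there (insert-new a)

  insert-head : ∀ {p n} (a : Adj y z p) → Head n p → Head n (insert a u w)
  insert-head fwd       first = first
  insert-head bwd       first = first
  insert-head (there a) first = first

  insert-end : ∀ {p n} (a : Adj y z p) → End n p → End n (insert a u w)
  insert-end fwd       (there e) = there (there (there e))
  insert-end bwd       (there e) = there (there (there e))
  insert-end (there a) (there e) = there (insert-end a e)

-- Insertion separates only `y` from `suc y`. An overlapping pair such as `suc y`, `suc (suc y)`
-- stays adjacent, since the new vertices arrive on the other side of `suc y`.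
insert-domino : ∀ {y z p u w} (a : Domino y p) → z ≢ y → Domino z p → Domino z (insert a u w)
insert-domino fwd z≢y fwd = contradiction refl z≢y
insert-domino fwd z≢y (there b) = there (there (there b))
insert-domino bwd z≢y bwd = contradiction refl z≢y
insert-domino bwd z≢y (there b) = there (there (there b))
insert-domino (there fwd) z≢y fwd = fwd
insert-domino (there bwd) z≢y fwd = fwd
insert-domino (there (there a)) z≢y fwd = fwd
insert-domino (there fwd) z≢y bwd = bwd
insert-domino (there bwd) z≢y bwd = bwd
insert-domino (there (there a)) z≢y bwd = bwd
insert-domino (there a) z≢y (there b) = there (insert-domino a z≢y b)

-- Lifts and families of dominoes

∣n-1+n∣≡1 : ∀ n → ∣ n - suc n ∣ ≡ 1
∣n-1+n∣≡1 zero    = refl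
∣n-1+n∣≡1 (suc n) = ∣n-1+n∣≡1 n

lift-linear : ∀ {y l v L p} (a : Domino y p) → v ≡ y + l → IsLinear v L p →
  IsLinear (suc (suc v)) (l ∷ l ∷ L) (insert a v (suc v))
lift-linear {y} {l} {L = L} a refl P = linear
  (↭-trans (insert-↭ _ _ a) (↭-trans (swap _ _ ↭-refl) (prep _ (prep _ (covers P)))))
  (↭-trans (insert-steps _ _ a (∣m-m+n∣≡n y l)
             (trans (∣n-1+n∣≡1 (y + l)) (sym (∣n-1+n∣≡1 y)))
             (trans (∣-∣-comm (y + l) y) (∣m-m+n∣≡n y l)))
           (prep l (prep l (lengths P))))

-- Structural recursion makes one more domino and two more vertices agree by computation.
double : ℕ → ℕ
double zero    = zero
double (suc n) = suc (suc (double n))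

double-+ : ∀ m n → double (m + n) ≡ double m + double n
double-+ zero    n = refl
double-+ (suc m) n = cong (suc ∘ suc) (double-+ m n)

double≡+ : ∀ n → double n ≡ n + n
double≡+ zero    = refl
double≡+ (suc n) = cong suc (trans (cong suc (double≡+ n)) (sym (+-suc n n)))

double-mono : ∀ {m n} → m ≤ n → double m ≤ double n
double-mono z≤n       = z≤n
double-mono (s≤s m≤n) = s≤s (s≤s (double-mono m≤n))

double-cancel-≤ : ∀ {m n} → double m ≤ double n → m ≤ n
double-cancel-≤ {zero}  {n}     _             = z≤n
double-cancel-≤ {suc m} {suc n} (s≤s (s≤s le)) = s≤s (double-cancel-≤ le)

double-cancel-< : ∀ {m n} → suc (double m) ≤ double n → m < n
double-cancel-< {zero}  {suc n} _             = s≤s z≤n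
double-cancel-< {suc m} {suc n} (s≤s (s≤s le)) = s≤s (double-cancel-< le)

double≡*2 : ∀ n → double n ≡ n * 2
double≡*2 zero    = refl
double≡*2 (suc n) = cong (suc ∘ suc) (double≡*2 n)

parity : ∀ n → (∃ λ h → n ≡ double h) ⊎ (∃ λ h → n ≡ suc (double h))
parity zero    = inj₁ (0 , refl)
parity (suc n) = [ (λ { (h , refl) → inj₂ (h , refl) }) , (λ { (h , refl) → inj₁ (suc h , refl) }) ]′ (parity n)

double-shift : ∀ i y → double i + suc (suc y) ≡ suc (suc (double i + y))
double-shift i y = trans (+-suc (double i) (suc y)) (cong suc (+-suc (double i) y))

Dominoes : ℕ → ℕ → List ℕ → Set
Dominoes y zero    p = ⊤
Dominoes y (suc i) p = Domino y p × Dominoes (suc (suc y)) i p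

dominoes : ∀ i y {p} → (∀ z → y ≤ z → suc z < double i + y → Domino z p) → Dominoes y i p
dominoes zero    y D = tt
dominoes (suc i) y D =
  D y ≤-refl (s≤s (s≤s (m≤n+m y (double i)))) ,
  dominoes i (suc (suc y)) λ z y≤z z< →
    D z (≤-trans (n≤1+n y) (≤-trans (n≤1+n (suc y)) y≤z)) (subst (suc z <_) (double-shift i y) z<)

dominoes-map : ∀ i y {p p'} → (∀ z → y ≤ z → Domino z p → Domino z p') →
  Dominoes y i p → Dominoes y i p'
dominoes-map zero    y f D       = tt
dominoes-map (suc i) y f (d , D) = f y ≤-refl d ,
  dominoes-map i (suc (suc y)) (λ z y≤z → f z (≤-trans (n≤1+n y) (≤-trans (n≤1+n (suc y)) y≤z))) D

dominoes-++ : ∀ k i {y p} → Dominoes y k p → Dominoes (double k + y) i p → Dominoes y (k + i) p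
dominoes-++ zero    i D       E = E
dominoes-++ (suc k) i {y} {p} (d , D) E =
  d , dominoes-++ k i D (subst (λ z → Dominoes z i p) (sym (double-shift k y)) E)

-- The bound means z ≥ y - 1: when the dominoes below `y` have been opened, the pair y - 1, y is
-- still intact, and `mix` starts its second family there.
record Keeps (y : ℕ) (p p' : List ℕ) : Set where
  field
    domino : ∀ z → y ≤ suc z → Domino z p → Domino z p'
    head   : ∀ {n} → Head n p → Head n p'
    end    : ∀ {n} → End n p → End n p'

open Keeps

keeps-refl : ∀ {y p} → Keeps y p p
keeps-refl = record { domino = λ _ _ → id ; head = id ; end = id }

keeps-trans : ∀ {y y' p p' p''} → y' ≤ y → Keeps y' p p' → Keeps y p' p'' → Keeps y p p''
keeps-trans y'≤y K K' = record
  { domino = λ z y≤ → domino K' z y≤ ∘ domino K z (≤-trans y'≤y y≤)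
  ; head   = head K' ∘ head K
  ; end    = end K' ∘ end K
  }

insert-keeps : ∀ {y p u w} (a : Domino y p) → Keeps (suc (suc y)) p (insert a u w)
insert-keeps a = record
  { domino = λ { z (s≤s y<z) → insert-domino a (>⇒≢ y<z) }
  ; head   = insert-head _ _ a
  ; end    = insert-end _ _ a
  }

replicate-shift : ∀ n (l : ℕ) L → replicate n l ++ l ∷ l ∷ L ↭ l ∷ l ∷ replicate n l ++ L
replicate-shift n l L = ↭-trans (shift l (replicate n l) _) (prep l (shift l (replicate n l) _))

-- Each lift moves on by two in the family at `y` and raises the order by two, so the difference
-- stays `l`. The bound on `i` protects the new dominoes: they start at y + l, which is at least y +
-- 2i - 1.
lifts : ∀ i {y l v L p} → double i ≤ suc l → v ≡ y + l → IsLinear v L p → Dominoes y i p →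
  ∃ λ p' → IsLinear (double i + v) (replicate (double i) l ++ L) p' ×
           Dominoes v i p' × Keeps (double i + y) p p'
lifts zero    _ _ P _ = _ , P , tt , keeps-refl
lifts (suc i) {y} {l} {v} {L} i≤ refl P (d , D)
  with lifts i {suc (suc y)} {l} (≤-trans (n≤1+n _) (≤-trans (n≤1+n _) i≤)) refl
         (lift-linear d refl P)
         (dominoes-map i (suc (suc y)) (λ z y≤z → domino (insert-keeps d) z (≤-trans y≤z (n≤1+n z))) D)
... | p' , P' , D' , K rewrite double-shift i v | double-shift i y =
  p' ,
  linear (covers P') (↭-trans (lengths P') (replicate-shift (double i) l L)) ,
  (domino K v (≤-trans (+-monoˡ-≤ y i≤) (s≤s (≤-reflexive (+-comm l y)))) (insert-new _ _ d) , D') ,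
  keeps-trans (s≤s (s≤s (m≤n+m y (double i)))) (insert-keeps d) K

-- Rooted paths and unlimited growth

record Rooted (L : List ℕ) : Set where
  constructor rooted
  field
    {order} : ℕ
    {path}  : List ℕ
    isLin   : IsLinear order L path
    ends    : End 0 path

rooted-resp : ∀ {L L'} → L ↭ L' → Rooted L → Rooted L'
rooted-resp L↭ (rooted (linear c l) e) = rooted (linear c (↭-trans l L↭)) e

-- A window of h+1 dominoes at the top is reproduced by a lift, so lifting never gets stuck.
grow : ∀ n h {y v L p} → v ≡ y + double (suc h) → IsLinear v L p → End 0 p →
  Dominoes y (suc h) p → Rooted (replicate (double n) (double (suc h)) ++ L)
grow zero    h v≡ P e D = rooted P e
grow (suc n) h {y} {v} {L} {p} v≡ P e (d , D) =
  rooted-resp (replicate-shift (double n) _ L)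
    (grow n h (cong (suc ∘ suc) v≡) (lift-linear d v≡ P) (end K e)
      (subst (λ m → Dominoes (suc (suc y)) m (insert d v (suc v))) (+-comm h 1)
        (dominoes-++ h 1
          (dominoes-map h _ (λ z y≤z → domino K z (≤-trans y≤z (n≤1+n z))) D)
          (subst (λ z → Domino z (insert d v (suc v))) (trans v≡ eq) (insert-new _ _ d) , tt))))
  where
  K = insert-keeps {u = v} {suc v} d
  eq : y + double (suc h) ≡ double h + suc (suc y)
  eq = trans (+-comm y _) (sym (double-shift h y))

-- First i lifts of length l, then lifts of the even length 2(h+1). In the applications y' = y + 2i - 1:
-- the second family pairs the upper vertex of the last lifted domino with its successor.
mix : ∀ i k n h {y y' l v L p} → k + i ≡ suc h →
  v ≡ y + l → v ≡ double k + y' → double i + y ≤ suc y' →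
  IsLinear v L p → End 0 p → Dominoes y i p → Dominoes y' k p →
  Rooted (replicate (double n) (double (suc h)) ++ replicate (double i) l ++ L)
mix i k n h {y} {y'} {l} {v} k+i≡ v≡ v≡' y≤ P e D D'
  with lifts i {y} {l} i≤ v≡ P D
  where
  i≤ : double i ≤ suc l
  i≤ = +-cancelʳ-≤ y _ _ (begin
    double i + y       ≤⟨ y≤ ⟩
    suc y'             ≤⟨ s≤s (m≤n+m y' (double k)) ⟩
    suc (double k + y') ≡⟨ cong suc (trans (sym v≡') v≡) ⟩
    suc (y + l)        ≡⟨ cong suc (+-comm y l) ⟩
    suc l + y          ∎)
    where open ≤-Reasoning
... | p' , P' , N , K = grow n h eq P' (end K e)
  (subst (λ m → Dominoes y' m p') k+i≡
    (dominoes-++ k i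
      (dominoes-map k y' (λ z y≤z → domino K z (≤-trans y≤ (s≤s y≤z))) D')
      (subst (λ z → Dominoes z i p') v≡' N)))
  where
  eq : double i + v ≡ y' + double (suc h)
  eq = trans (cong (double i +_) v≡')
      (trans (sym (+-assoc (double i) (double k) y'))
      (trans (+-comm _ y') (cong (y' +_)
        (trans (+-comm (double i) (double k)) (trans (sym (double-+ k i)) (cong double k+i≡))))))

-- Runs and folds

ups : ℕ → ℕ → List ℕ
ups s zero    = []
ups s (suc n) = s ∷ ups (suc s) n

domino-ups : ∀ n s z → s ≤ z → suc z < n + s → Domino z (ups s n)
domino-ups zero          s z s≤z z< = contradiction (≤-trans z< s≤z) (<-asym (n<1+n z))
domino-ups (suc zero)    s z s≤z (s≤s z<) = contradiction (≤-trans z< s≤z) (<-irrefl refl)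
domino-ups (suc (suc n)) s z s≤z z< =
  [ (λ s<z → there (domino-ups (suc n) (suc s) z s<z
              (subst (suc z <_) (sym (cong suc (+-suc n s))) z<)))
  , (λ { refl → fwd }) ]′ (m≤n⇒m<n∨m≡n s≤z)

domino-downFrom : ∀ n z → suc z < n → Domino z (downFrom n)
domino-downFrom (suc (suc n)) z (s≤s z<) =
  [ (λ z<n → there (domino-downFrom (suc n) z z<n))
  , (λ { refl → bwd }) ]′ (m≤n⇒m<n∨m≡n z<)

steps-ups : ∀ n s q → steps (ups s (suc n) ++ q) ≡ replicate n 1 ++ gap (n + s) q ++ steps q
steps-ups zero    s q = refl
steps-ups (suc n) s q = cong₂ _∷_ (∣n-1+n∣≡1 s)
  (trans (steps-ups n (suc s) q)
    (cong (λ m → replicate n 1 ++ gap m q ++ steps q) (+-suc n s)))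

steps-downFrom : ∀ n → steps (downFrom (suc n)) ≡ replicate n 1
steps-downFrom zero    = refl
steps-downFrom (suc n) = cong₂ _∷_ (trans (∣-∣-comm (suc n) n) (∣n-1+n∣≡1 n)) (steps-downFrom n)

downFrom-+ : ∀ n v → map (n +_) (downFrom v) ++ downFrom n ≡ downFrom (v + n)
downFrom-+ n zero    = refl
downFrom-+ n (suc v) = cong₂ _∷_ (+-comm n v) (downFrom-+ n v)

ups-↭ : ∀ n s → ups s n ↭ map (s +_) (downFrom n)
ups-↭ zero    s = ↭-refl
ups-↭ (suc n) s = ↭-trans (prep s (ups-↭ n (suc s))) (lemma n s)
  where
  lemma : ∀ n s → s ∷ map (suc s +_) (downFrom n) ↭ map (s +_) (downFrom (suc n))
  lemma zero    s = ↭-reflexive (cong (_∷ []) (sym (+-identityʳ s)))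
  lemma (suc n) s = ↭-trans (swap s (suc (s + n)) ↭-refl)
    (↭-trans (prep _ (lemma n s)) (↭-reflexive (cong (_∷ map (s +_) (downFrom (suc n))) (sym (+-suc s n)))))

ups-downFrom : ∀ n s → ups s n ++ downFrom s ↭ downFrom (n + s)
ups-downFrom n s = ↭-trans (++⁺ʳ (downFrom s) (ups-↭ n s)) (↭-reflexive (downFrom-+ s n))

end-downFrom : ∀ n → End 0 (downFrom (suc n))
end-downFrom zero    = last
end-downFrom (suc n) = there (end-downFrom n)

end-++ : ∀ p {q n} → End n q → End n (p ++ q)
end-++ []      e = e
end-++ (w ∷ p) e = there (end-++ p e)

flat : ∀ n → IsLinear (suc n) (replicate n 1) (downFrom (suc n))
flat n = linear ↭-refl (↭-reflexive (steps-downFrom n))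

-- The fold 1, 2, …, l, 0 of length l = n + 1.
fold : ∀ n → IsLinear (suc (suc n)) (replicate n 1 ++ suc n ∷ []) (ups 1 (suc n) ++ 0 ∷ [])
fold n = linear
  (↭-trans (ups-downFrom (suc n) 1) (↭-reflexive (cong downFrom (+-comm (suc n) 1))))
  (↭-reflexive (trans (steps-ups n 1 (0 ∷ []))
    (cong (λ m → replicate n 1 ++ m ∷ []) (cong (λ m → ∣ m - 0 ∣) (+-comm n 1)))))

-- Stacking paths

gap-map : ∀ n y p → gap (n + y) (map (n +_) p) ≡ gap y p
gap-map n y []      = refl
gap-map n y (z ∷ p) = cong (_∷ []) (∣m+n-m+o∣≡∣n-o∣ n y z)

-- The shifted `s` ends at `n + 0`, which takes over the role of the head `n` of the lower path, so
-- no edge is gained or lost at the seam.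
steps-join : ∀ n {s} t → End 0 s → steps (map (n +_) s ++ t) ≡ steps s ++ steps (n ∷ t)
steps-join n t last rewrite +-identityʳ n = refl
steps-join n t (there {w} {p} e) =
  trans (cong₂ _++_ (trans (gap-++ e) (gap-map n w p)) (steps-join n t e))
        (sym (++-assoc (gap w p) (steps p) (steps (n ∷ t))))
  where
  gap-++ : ∀ {p m} → End 0 p → gap m (map (n +_) p ++ t) ≡ gap m (map (n +_) p)
  gap-++ last      = refl
  gap-++ (there e) = refl

join : ∀ {n v L M s t} → IsLinear v L s → End 0 s → IsLinear (suc n) M (n ∷ t) →
  IsLinear (v + n) (L ++ M) (map (n +_) s ++ t)
join {n} {v} {s = s} {t} S e T = linear
  -- The shared vertex `n` already occurs in the shifted upper path and is dropped from the lower
  -- one.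
  (↭-trans (++⁺ (map⁺ (n +_) (covers S)) (drop-∷ (covers T))) (↭-reflexive (downFrom-+ n v)))
  (↭-trans (↭-reflexive (steps-join n t e)) (++⁺ (lengths S) (lengths T)))

join-end : ∀ {n s t} → End 0 s → End 0 (n ∷ t) → End 0 (map (n +_) s ++ t)
join-end {n} last e rewrite +-identityʳ n = e
join-end (there e) e' = there (join-end e e')

-- Capped and perfect paths

-- With the other end left free, such a path can carry a rooted path, but the resulting stack need
-- not be rooted.
record Capped (L : List ℕ) : Set where
  constructor capped
  field
    {size}  : ℕ
    {tail}  : List ℕ
    isLin   : IsLinear (suc size) L (size ∷ tail)

record Perfect (L : List ℕ) : Set where
  constructor perfect
  field
    {size}  : ℕ
    {tail}  : List ℕ
    isLin   : IsLinear (suc size) L (size ∷ tail)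
    ends    : End 0 (size ∷ tail)

extend : ∀ {L M} → Rooted L → Perfect M → Rooted (L ++ M)
extend (rooted S e) (perfect T e') = rooted (join S e T) (join-end e e')

-- Replacing z by n - z preserves differences between vertices up to `n` and sends the first vertex
-- 0 to the top. Lifts keep the head, so a path lifted from head 0 becomes capped.
reflect : ∀ {v n L p} → v ≡ suc n → IsLinear v L p → Head 0 p → Capped L
reflect {n = n} {L} {_ ∷ p} refl S first = capped (linear
  (↭-trans (map⁺ (n ∸_) (covers S)) (flip-↭ n))
  (↭-trans (↭-reflexive (flip-steps (0 ∷ p) bound)) (lengths S)))
  where
  below : ∀ m → m ≤ suc n → All (_≤ n) (downFrom m)
  below zero    _         = []
  below (suc m) (s≤s m≤n) = m≤n ∷ below m (m≤n⇒m≤1+n m≤n)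

  bound : All (_≤ n) (0 ∷ p)
  bound = All-resp-↭ (↭-sym (covers S)) (below (suc n) ≤-refl)

  flip-↭ : ∀ n → map (n ∸_) (downFrom (suc n)) ↭ downFrom (suc n)
  flip-↭ n = ↭-trans (↭-reflexive (go n 0 (+-identityʳ n)))
    (↭-trans (ups-↭ (suc n) 0) (↭-reflexive (map-id _)))
    where
    go : ∀ m s → m + s ≡ n → map (n ∸_) (downFrom (suc m)) ≡ ups s (suc m)
    go zero    s refl = refl
    go (suc m) s refl = cong₂ _∷_ (m+n∸m≡n (suc m) s) (go m (suc s) (+-suc m s))

  ∸-∸ : ∀ y {z} → z ≤ n → n ∸ y ∸ (n ∸ z) ≡ z ∸ y
  ∸-∸ y {z} le = trans (∸-+-assoc n y (n ∸ z))
    (trans (cong (n ∸_) (+-comm y (n ∸ z)))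
    (trans (sym (∸-+-assoc n (n ∸ z) y)) (cong (_∸ y) (m∸[m∸n]≡n le))))

  flip : ∀ {y z} → y ≤ n → z ≤ n → ∣ n ∸ y - n ∸ z ∣ ≡ ∣ y - z ∣
  flip {y} {z} y≤ z≤ with ≤-total y z
  ... | inj₁ y≤z = trans (m≤n⇒∣n-m∣≡n∸m (∸-monoʳ-≤ n y≤z))
        (trans (∸-∸ y z≤) (sym (m≤n⇒∣m-n∣≡n∸m y≤z)))
  ... | inj₂ z≤y = trans (m≤n⇒∣m-n∣≡n∸m (∸-monoʳ-≤ n z≤y))
        (trans (∸-∸ z y≤) (sym (m≤n⇒∣n-m∣≡n∸m z≤y)))

  flip-steps : ∀ q → All (_≤ n) q → steps (map (n ∸_) q) ≡ steps q
  flip-steps []          _                 = refl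
  flip-steps (y ∷ [])    _                 = refl
  flip-steps (y ∷ z ∷ q) (y≤ ∷ z≤ ∷ q≤) = cong₂ _∷_ (flip y≤ z≤) (flip-steps (z ∷ q) (z≤ ∷ q≤))

-- The zigzag 0, x+1, 1, x+2, …, n-1, n+x, listed from its upper end; for n = x+1 it covers 0, …, 2x+1.
zigzag : ℕ → ℕ → List ℕ
zigzag x zero    = []
zigzag x (suc n) = suc x + n ∷ n ∷ zigzag x n

zigzag-↭ : ∀ x n → zigzag x n ↭ map (suc x +_) (downFrom n) ++ downFrom n
zigzag-↭ x zero    = ↭-refl
zigzag-↭ x (suc n) = prep _ (↭-trans (prep n (zigzag-↭ x n))
  (↭-sym (shift n (map (suc x +_) (downFrom n)) (downFrom n))))

zigzag-end : ∀ x n → End 0 (zigzag x (suc n))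
zigzag-end x zero    = there last
zigzag-end x (suc n) = there (there (zigzag-end x n))

theList-short : ∀ x a b c → x ∷ theList x a b c ↭ theList x a (suc b) c
theList-short x a b c = ↭-sym (shift x (replicate a 1) _)

theList-long : ∀ x a b c → suc x ∷ theList x a b c ↭ theList x a b (suc c)
theList-long x a b c = ↭-sym (↭-trans
  (++⁺ˡ (replicate a 1) (shift (suc x) (replicate b x) _)) (shift (suc x) (replicate a 1) _))

zigzag-steps : ∀ x n → steps (zigzag x (suc n)) ↭ theList x 0 n (suc n)
zigzag-steps x zero    = ↭-reflexive (cong (λ m → suc m ∷ []) (+-identityʳ x))
zigzag-steps x (suc n) =
  ↭-trans (↭-reflexive (cong₂ (λ k l → k ∷ l ∷ steps (zigzag x (suc n))) down up))
    (↭-trans (prep (suc x) (↭-trans (prep x (zigzag-steps x n)) (theList-short x 0 n (suc n))))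
      (theList-long x 0 (suc n) (suc n)))
  where
  down : ∣ suc x + suc n - suc n ∣ ≡ suc x
  down = trans (∣-∣-comm (suc x + suc n) (suc n))
           (trans (cong (∣ suc n -_∣) (+-comm (suc x) (suc n))) (∣m-m+n∣≡n (suc n) (suc x)))
  up : ∣ suc n - suc x + n ∣ ≡ x
  up = trans (cong (∣ n -_∣) (+-comm x n)) (∣m-m+n∣≡n n x)

zigzag-perfect : ∀ x → Perfect (theList x 0 x (suc x))
zigzag-perfect x = perfect {size = suc x + x} (linear
  (↭-trans (zigzag-↭ x (suc x)) (↭-reflexive
    (trans (downFrom-+ (suc x) (suc x)) (cong downFrom (+-suc (suc x) x)))))
  (zigzag-steps x x)) (zigzag-end x x)

-- The path runs up and down the residue classes modulo o = 2h+1 in turn and leaves at the top of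
-- the last one. A further layer of o vertices costs h lifts and one step of length o at that end.
snake : ∀ h q → ∃ λ y → ∃ λ t →
  IsLinear (suc (double h + y)) (replicate (q * suc (double h)) (suc (double h)) ++ replicate (double h) 1)
    (double h + y ∷ t) × End 0 (double h + y ∷ t) × Dominoes y h (double h + y ∷ t)
snake h zero = 0 , downFrom (double h) , start (sym (+-identityʳ (double h)))
  where
  start : ∀ {n} → double h ≡ n →
    IsLinear (suc n) (replicate (double h) 1) (n ∷ downFrom (double h)) ×
    End 0 (n ∷ downFrom (double h)) × Dominoes 0 h (n ∷ downFrom (double h))
  start refl = flat (double h) , end-downFrom (double h) ,
    dominoes h 0 λ z _ z< → domino-downFrom (suc (double h)) z
      (m<n⇒m<1+n (subst (suc z <_) (+-identityʳ (double h)) z<))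
snake h (suc q) with snake h q
... | y , t , S , e , D
  with lifts h {y} {suc (double h)} (≤-trans (n≤1+n _) (n≤1+n _))
         (trans (cong suc (+-comm (double h) y)) (sym (+-suc y (double h)))) S D
... | p' , P' , D' , K with head K first
... | first {t'} = suc (double h + y) , double h + y ∷ t' ,
  linear (prep _ (covers P'))
    (↭-trans (↭-reflexive (cong (_∷ steps (double h + y ∷ t')) jump))
    (prep _ (↭-trans (lengths P') (↭-reflexive
      (trans (sym (++-assoc (replicate (double h) _) _ _))
        (cong (_++ replicate (double h) 1) (sym (replicate-+ (double h) _)))))))) ,
  there (end K e) ,
  dominoes-map h _ (λ _ _ → there) D'
  where
  replicate-+ : ∀ m n {l : ℕ} → replicate (m + n) l ≡ replicate m l ++ replicate n l
  replicate-+ zero    n = refl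
  replicate-+ (suc m) n = cong (_ ∷_) (replicate-+ m n)
  jump : ∣ double h + suc (double h + y) - double h + y ∣ ≡ suc (double h)
  jump = trans (∣m+n-m+o∣≡∣n-o∣ (double h) (suc (double h + y)) y)
    (trans (∣-∣-comm (suc (double h + y)) y)
    (trans (cong (∣ y -_∣) (+-comm (suc (double h)) y)) (∣m-m+n∣≡n y (suc (double h)))))

snake-perfect : ∀ h q →
  Perfect (replicate (q * suc (double h)) (suc (double h)) ++ replicate (double h) 1)
snake-perfect h q with snake h q
... | _ , _ , S , e , _ = perfect S e

-- Ones together with a single larger length

domino-fold : ∀ n z → 1 ≤ z → z ≤ n → Domino z (ups 1 (suc n) ++ 0 ∷ [])
domino-fold n z 1≤z le = adj-++ _ (domino-ups (suc n) 1 z 1≤z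
  (s≤s (≤-trans (s≤s le) (≤-reflexive (+-comm 1 n)))))

end-fold : ∀ n → End 0 (ups 1 n ++ 0 ∷ [])
end-fold n = end-++ (ups 1 n) last

-- Lifts add edges in pairs, so the parity of `n` selects the base: the descending run on 0, ...,
-- 2h+1, or the fold, which already has one edge of length 2h+2. Either spends 2h+1 ones.
even-columns : ∀ h n → Rooted (replicate n (double (suc h)) ++ replicate (suc (double h)) 1)
even-columns h n with parity n
... | inj₁ (m , refl) = grow m h {0} refl (flat (suc (double h))) (end-downFrom _)
  (dominoes (suc h) 0 λ z _ z< → domino-downFrom (double (suc h)) z
    (≤-trans z< (≤-reflexive (+-identityʳ _))))
... | inj₂ (m , refl) = rooted-resp regroup
  (grow m h {1} refl (fold (suc (double h))) (end-fold (double (suc h)))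
    (dominoes (suc h) 1 λ z 1≤z z< → domino-fold (suc (double h)) z 1≤z
      (≤-pred (≤-pred (≤-trans z< (≤-reflexive (+-comm (double (suc h)) 1)))))))
  where
  x = double (suc h)
  regroup : replicate (double m) x ++ replicate (suc (double h)) 1 ++ x ∷ [] ↭
            x ∷ replicate (double m) x ++ replicate (suc (double h)) 1
  regroup = ↭-trans (++⁺ˡ (replicate (double m) x)
      (↭-trans (shift x (replicate (suc (double h)) 1) []) (↭-reflexive (cong (x ∷_) (++-identityʳ _)))))
    (shift x (replicate (double m) x) _)

steps-suc : ∀ p → steps (map suc p) ≡ steps p
steps-suc []      = refl
steps-suc (y ∷ p) = cong₂ _++_ (gap-map 1 y p) (steps-suc p)

-- A window of odd size is not tiled by dominoes, but n ≤ 2h asks for at most h lifts. Put o = 2h+1.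
-- The base is 0, ..., o-1 for even `n` and 0, o, o-1, ..., 1 for odd `n`; its head 0 becomes the
-- top by reflection.
odd-columns : ∀ h n → n ≤ double h →
  Capped (replicate n (suc (double h)) ++ replicate (double h) 1)
odd-columns h n n≤ with parity n
... | inj₁ (m , refl) with lifts m {0} (≤-trans n≤ (≤-trans (n≤1+n _) (n≤1+n _))) refl
        (linear {p = ups 0 (suc (double h))}
          (↭-trans (ups-↭ _ 0) (↭-reflexive (map-id _)))
          (↭-reflexive (trans (cong steps (sym (++-identityʳ (ups 0 (suc (double h))))))
            (trans (steps-ups (double h) 0 []) (++-identityʳ _)))))
        (dominoes m 0 λ z _ z< → domino-ups (suc (double h)) 0 z z≤n
          (≤-trans z< (≤-trans (+-monoˡ-≤ 0 n≤) (n≤1+n _))))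

... | p' , P' , _ , K = reflect (+-suc (double m) (double h)) P' (head K first)
odd-columns h n n≤ | inj₂ (m , refl) with lifts m {1} {suc (double h)}
        (≤-trans (n≤1+n _) (≤-trans n≤ (≤-trans (n≤1+n _) (n≤1+n _)))) refl
        (linear {p = 0 ∷ map suc (downFrom (suc (double h)))}
          (↭-trans (∷↭∷ʳ 0 (map suc (downFrom (suc (double h)))))
            (↭-reflexive (trans (downFrom-+ 1 (suc (double h))) (cong downFrom (+-comm (suc (double h)) 1)))))
          (prep (suc (double h)) (↭-reflexive
            (trans (steps-suc (downFrom (suc (double h)))) (steps-downFrom (double h))))))
        (dominoes m 1 λ { (suc z) _ z< → there (adj-map suc (domino-downFrom (suc (double h)) z
          (≤-trans (≤-pred (≤-trans z< (≤-reflexive (+-comm (double m) 1)))) (≤-trans (n≤1+n _) (≤-trans n≤ (n≤1+n _)))))) })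

... | p' , P' , _ , K with reflect (+-suc (double m) (suc (double h))) P' (head K first)
... | capped (linear c l) = capped (linear c (↭-trans l (shift (suc (double h)) (replicate (double m) _) _)))

-- Bookkeeping for the three lengths

Standard : ℕ → ℕ → ℕ → ℕ → Set
Standard x a b c = Rooted (theList x a b c)

theList-shorts : ∀ n x a b c → replicate n x ++ theList x a b c ↭ theList x a (n + b) c
theList-shorts zero    x a b c = ↭-refl
theList-shorts (suc n) x a b c = ↭-trans (prep x (theList-shorts n x a b c)) (theList-short x a (n + b) c)

theList-longs : ∀ n x a b c → replicate n (suc x) ++ theList x a b c ↭ theList x a b (n + c)
theList-longs zero    x a b c = ↭-refl
theList-longs (suc n) x a b c = ↭-trans (prep (suc x) (theList-longs n x a b c)) (theList-long x a b (n + c))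

theList-ones : ∀ n x → replicate n 1 ↭ theList x n 0 0
theList-ones n x = ↭-reflexive (sym (++-identityʳ _))

theList-++ : ∀ x a b c a' b' c' →
  theList x a b c ++ theList x a' b' c' ↭ theList x (a + a') (b + b') (c + c')
theList-++ x zero zero    c a' b' c' = theList-longs c x a' b' c'
theList-++ x zero (suc b) c a' b' c' =
  ↭-trans (prep x (theList-++ x zero b c a' b' c')) (theList-short x a' (b + b') (c + c'))
theList-++ x (suc a) b c a' b' c' = prep 1 (theList-++ x a b c a' b' c')

mixed : ∀ x n i a b c {b' c' L} → double i + b ≡ b' → double n + c ≡ c' → L ↭ theList x a b c →
  Rooted (replicate (double n) (suc x) ++ replicate (double i) x ++ L) → Standard x a b' c'
mixed x n i a b c refl refl L↭ = rooted-resp (↭-trans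
  (++⁺ˡ (replicate (double n) (suc x)) (↭-trans (++⁺ˡ (replicate (double i) x) L↭)
    (theList-shorts (double i) x a b c)))
  (theList-longs (double n) x a _ c))

-- Base paths for odd x, by the parities of b and c

module _ (j k n : ℕ) where

  -- The fold 1, ..., x+1, 0 supplies the odd edge of length x+1. It has x+2 vertices, so lifts of
  -- length x start at 2. After `j` of them the window starts at 2j+1 and consists of k+1 old and j
  -- new dominoes, x+1 vertices in all.
  odd-long-even-short : let x = suc (double (k + j)) in
    Standard x x (double j) (suc (double n))
  odd-long-even-short =
    mixed x n j x 0 1 (+-identityʳ _) (+-comm (double n) 1) ↭-refl
      (mix j (suc k) n (k + j) {2} {suc (double j)} refl refl (sym fits)
        (≤-reflexive (+-comm (double j) 2))
        (fold x) (end-fold (suc x))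
        (dominoes j 2 λ z 2≤z z< → domino-fold x z (≤-trans (n≤1+n 1) 2≤z)
          (≤-trans (≤-pred (≤-pred (≤-trans z< (≤-reflexive (+-comm (double j) 2)))))
            (≤-trans (double-mono (m≤n+m j k)) (n≤1+n _))))
        (dominoes (suc k) (suc (double j)) λ z z> z< → domino-fold x z (≤-trans (s≤s z≤n) z>)
          (≤-pred (≤-pred (≤-trans z< (≤-reflexive fits))))))
    where
    x = suc (double (k + j))
    fits : double (suc k) + suc (double j) ≡ suc (suc x)
    fits = cong (suc ∘ suc) (trans (+-suc (double k) (double j)) (cong suc (sym (double-+ k j))))

  -- The base path is x+1, x+2, 1, 2, …, x, 0.
  odd-long-odd-short : let x = suc (double (suc (k + j))) in
    Standard x x (suc (double j)) (suc (double n))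
  odd-long-odd-short =
    mixed x n j x 1 1 (+-comm (double j) 1) (+-comm (double n) 1)
      (prep 1 (theList-long x w 1 0))
      (mix j (suc (suc k)) n (suc (k + j)) {3} {suc (suc (double j))}
        (cong (suc ∘ suc) refl) refl (cong (suc ∘ suc) (sym fits))
        (≤-reflexive (+-comm (double j) 3))
        (linear {p = p}
          (↭-trans (swap _ _ ↭-refl) (prep _ (prep _ (covers (fold w)))))
          (↭-trans (↭-reflexive (cong (_∷ suc x ∷ steps (ups 1 x ++ 0 ∷ [])) (∣n-1+n∣≡1 x)))
            (prep 1 (prep (suc x) (lengths (fold w))))))
        (there (there (end-fold x)))
        (dominoes j 3 λ z 3≤z z< → there (there (domino-fold w z (≤-trans (s≤s z≤n) 3≤z)
          (≤-trans (≤-pred (≤-pred (≤-trans z< (≤-reflexive (+-comm (double j) 3)))))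
            (s≤s (≤-trans (double-mono (m≤n+m j k)) (n≤1+n _)))))))
        (subst (λ m → Dominoes (suc (suc (double j))) m p) (cong suc (+-comm k 1))
          (dominoes-++ (suc k) 1
            (dominoes (suc k) (suc (suc (double j))) λ z z> z< →
              there (there (domino-fold w z (≤-trans (s≤s z≤n) z>)
                (≤-pred (≤-pred (≤-trans z< (≤-reflexive fits)))))))
            (subst (λ y → Domino y p) (sym fits) fwd , tt))))
    where
    w = double (suc (k + j))
    x = suc w
    p = suc x ∷ suc (suc x) ∷ ups 1 x ++ 0 ∷ []
    fits : double (suc k) + suc (suc (double j)) ≡ suc x
    fits = cong (suc ∘ suc) (trans (double-shift k (double j)) (cong (suc ∘ suc) (sym (double-+ k j))))

  -- The base is the run on 0, ..., x-1, lifted from 0. The count is `suc j` because with no lift of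
  -- length x the window of x+1 vertices would have to begin at -1.
  even-long-even-short : let x = suc (double (k + suc j)) in
    Standard x (double (k + suc j)) (double (suc j)) (double n)
  even-long-even-short =
    mixed x n (suc j) (double (k + suc j)) 0 0 (+-identityʳ _) (+-identityʳ _) (theList-ones _ x)
      (mix (suc j) (suc k) n (k + suc j) {0} {suc (double j)} refl refl
        (sym fits) (≤-reflexive (+-identityʳ _))
        (flat (double (k + suc j))) (end-downFrom (double (k + suc j)))
        (dominoes (suc j) 0 λ z _ z< → domino-downFrom x z
          (≤-trans z< (≤-trans (≤-reflexive (+-identityʳ _))
            (≤-trans (double-mono (m≤n+m (suc j) k)) (n≤1+n _)))))
        (dominoes (suc k) (suc (double j)) λ z _ z< → domino-downFrom x z
          (≤-trans z< (≤-reflexive fits))))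
    where
    x = suc (double (k + suc j))
    fits : double (suc k) + suc (double j) ≡ x
    fits = cong suc (trans (cong suc (+-suc (double k) (double j)))
            (trans (sym (double-shift k (double j))) (sym (double-+ k (suc j)))))

  -- The fold 1, ..., x, 0 supplies the odd edge of length x. With no lift of length x the window
  -- would begin with 0, 1, which are not neighbours in the fold; so b = 1 is treated apart.
  even-long-odd-short : let x = suc (double (k + suc j)) in
    Standard x (double (k + suc j)) (suc (double (suc j))) (double n)
  even-long-odd-short =
    mixed x n (suc j) (double (k + suc j)) 1 0 (+-comm _ 1) (+-identityʳ _) ↭-refl
      (mix (suc j) (suc k) n (k + suc j) {1} {double (suc j)} refl refl
        (double-+ (suc k) (suc j)) (≤-reflexive (+-comm _ 1))
        (fold (double (k + suc j))) (end-fold x)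
        (dominoes (suc j) 1 λ z 1≤z z< → domino-fold (double (k + suc j)) z 1≤z
          (≤-trans (n≤1+n z) (≤-trans (≤-pred (≤-trans z< (≤-reflexive (+-comm _ 1))))
            (double-mono (m≤n+m (suc j) k)))))
        (dominoes (suc k) (double (suc j)) λ z z> z< →
          domino-fold (double (k + suc j)) z (≤-trans (s≤s z≤n) z>)
            (≤-pred (≤-pred (≤-trans z< (≤-reflexive (sym (double-+ (suc k) (suc j)))))))))
    where
    x = suc (double (k + suc j))

-- The path 0, …, x-2, 2x-1, …, x+1, 2x+1, 2x, x-1, x, listed backwards, with x = w + 2.
module _ (w : ℕ) where
  private
    x = suc (suc w)
    t = suc w + suc x

  twice-folded : List ℕ
  twice-folded = x ∷ suc w ∷ t ∷ suc t ∷ ups (suc x) (suc w) ++ downFrom (suc w)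

  twice-folded-linear : IsLinear (suc (suc t)) (theList x (suc (suc (w + w))) 1 2) twice-folded
  twice-folded-linear = linear
    (↭-trans (shifts (x ∷ suc w ∷ []) (t ∷ suc t ∷ []))
      (↭-trans (swap _ _ (↭-trans (shifts (x ∷ suc w ∷ []) (ups (suc x) (suc w))) (ups-downFrom (suc w) (suc x))))
        ↭-refl))
    (↭-trans (↭-reflexive (cong₂ _++_ turns runs))
      (prep 1 (↭-trans (prep (suc x) (prep 1 (prep x (↭-trans (shift (suc x) (replicate w 1) (replicate w 1))
        (prep (suc x) (↭-trans (++⁺ (theList-ones w x) (theList-ones w x)) (theList-++ x w 0 0 w 0 0)))))))
      (↭-trans (prep (suc x) (prep 1 (↭-trans (prep x (theList-long x (w + w) 0 0))
        (theList-short x (w + w) 0 1)))) (theList-long x (suc (w + w)) 1 1)))))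
    where
    turns : ∣ x - suc w ∣ ∷ ∣ suc w - t ∣ ∷ ∣ t - suc t ∣ ∷ ∣ suc t - suc x ∣ ∷ [] ≡ 1 ∷ suc x ∷ 1 ∷ x ∷ []
    turns = cong₂ _∷_ (trans (∣-∣-comm x (suc w)) (∣n-1+n∣≡1 (suc w)))
      (cong₂ _∷_ (∣m-m+n∣≡n (suc w) (suc x))
      (cong₂ _∷_ (∣n-1+n∣≡1 t)
      (cong (_∷ []) (trans (∣-∣-comm (suc t) (suc x))
        (trans (cong (∣ suc x -_∣) (+-comm x (suc x))) (∣m-m+n∣≡n (suc x) x))))))
    runs : steps (ups (suc x) (suc w) ++ downFrom (suc w)) ≡ replicate w 1 ++ suc x ∷ replicate w 1
    runs = trans (steps-ups w (suc x) (downFrom (suc w)))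
      (cong (replicate w 1 ++_) (cong₂ _∷_
        (trans (∣-∣-comm (w + suc x) w) (∣m-m+n∣≡n w (suc x))) (steps-downFrom w)))

-- This settles b = 1 with c even and positive. The vertices x+1, ..., 2x+1 of `twice-folded` are
-- tiled by dominoes, g+1 from its ascending run and the pair 2x, 2x+1, so lifts of length x+1 can
-- continue from there.
even-long-one-short : ∀ g n → let x = suc (double (suc g)) in
  Standard x (double (double (suc g))) 1 (double (suc n))
even-long-one-short g n = subst (λ a → Standard x a 1 (double (suc n))) ones
  (rooted-resp (↭-trans (theList-longs (double n) x (suc (suc (w + w))) 1 2)
      (↭-reflexive (cong (theList x (suc (suc (w + w))) 1) (+-comm (double n) 2))))
    (grow n (suc g) {suc x} order (twice-folded-linear w)
      (there (there (there (there (end-++ (ups (suc x) (suc w)) (end-downFrom w))))))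
      (subst (λ m → Dominoes (suc x) m (twice-folded w)) (cong suc (+-comm g 1))
        (dominoes-++ (suc g) 1
          (dominoes (suc g) (suc x) λ z z≥ z< →
            there (there (there (there (adj-++ _ (domino-ups (suc w) (suc x) z z≥ z<))))))
          (there (there fwd) , tt)))))
  where
  w = suc (double g)
  x = suc (suc w)
  order : suc (suc (suc w + suc x)) ≡ suc x + double (suc (suc g))
  order = trans (cong (suc ∘ suc) (+-comm (suc w) (suc x)))
    (sym (trans (+-suc (suc x) x) (cong suc (+-suc (suc x) (suc w)))))
  ones : suc (suc (w + w)) ≡ double (double (suc g))
  ones = sym (trans (double≡+ (suc w)) (cong suc (+-suc w w)))

-- Assembling lists by stacking

record Linear (x a b c : ℕ) : Set where
  constructor line
  field
    {order start} : ℕ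
    {rest}        : List ℕ
    isLin         : IsLinear order (theList x a b c) (start ∷ rest)

standard⇒linear : ∀ {x a b c} → Standard x a b c → Linear x a b c
standard⇒linear (rooted {path = _ ∷ _} S e) = line S

cap : ∀ x a b c a' b' c' → Standard x a b c → Capped (theList x a' b' c') →
  Linear x (a + a') (b + b') (c + c')
cap x a b c a' b' c' (rooted {path = _ ∷ _} S e) (capped T) = line
  (linear (covers J) (↭-trans (lengths J) (theList-++ x a b c a' b' c')))
  where J = join S e T

stack : ∀ x a b c a' b' c' → Standard x a b c → Perfect (theList x a' b' c') →
  Standard x (a + a') (b + b') (c + c')
stack x a b c a' b' c' S P = rooted-resp (theList-++ x a b c a' b' c') (extend S P)

-- The descending run is a perfect path made of ones only, so surplus ones go underneath.
with-ones : ∀ x a₀ a b c → a₀ ≤ a → Standard x a₀ b c → Standard x a b c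
with-ones x a₀ a b c a₀≤a S = subst id
  (trans (cong (λ m → Standard x m (b + 0) (c + 0)) (m+[n∸m]≡n a₀≤a))
    (cong₂ (Standard x a) (+-identityʳ b) (+-identityʳ c)))
  (stack x a₀ b c (a ∸ a₀) 0 0 S
    (perfect (linear ↭-refl (↭-trans (↭-reflexive (steps-downFrom (a ∸ a₀))) (theList-ones (a ∸ a₀) x)))
             (end-downFrom (a ∸ a₀))))

with-zigzags : ∀ q x a b c → Standard x a b c → Standard x a (q * x + b) (q * suc x + c)
with-zigzags zero    x a b c S = S
with-zigzags (suc q) x a b c S = subst id
  (trans (cong (λ m → Standard x m (q * x + b + x) (q * suc x + c + suc x)) (+-identityʳ a))
    (cong₂ (Standard x a) (rotate (q * x) b x) (rotate (q * suc x) c (suc x))))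
  (stack x a (q * x + b) (q * suc x + c) 0 x (suc x) (with-zigzags q x a b c S) (zigzag-perfect x))
  where
  rotate : ∀ m n o → m + n + o ≡ o + m + n
  rotate m n o = trans (+-comm (m + n) o) (sym (+-assoc o m n))

-- Odd x with fewer than x edges of length x

module _ (g : ℕ) where
  private
    w = double (suc g)
    x = suc w

  -- The inequalities bound `a` by b+2x-3 and by 2x-2 without truncated subtraction. The base
  -- `even-long-one-short` attains both.
  OddBase : ℕ → ℕ → Set
  OddBase b c = ∃ λ a → a + 3 ≤ b + 2 * x × a + 2 ≤ 2 * x × Standard x a b c

  few-ones : ∀ b c {a} → a ≤ x → Standard x a b c → OddBase b c
  few-ones b c {a} a≤x S = a ,
    ≤-trans (+-mono-≤ a≤x 3≤x) (≤-trans x+x≤ (m≤n+m (2 * x) b)) ,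
    ≤-trans (+-mono-≤ a≤x (≤-trans (n≤1+n 2) 3≤x)) x+x≤ , S
    where
    3≤x : 3 ≤ x
    3≤x = s≤s (s≤s (s≤s z≤n))
    x+x≤ : x + x ≤ 2 * x
    x+x≤ = ≤-reflexive (cong (x +_) (sym (+-identityʳ x)))

  odd-base : ∀ b c → b < x → OddBase b c
  odd-base b c b<x with parity b | parity c
  ... | inj₁ (j , refl) | inj₂ (n , refl) = few-ones (double j) (suc (double n)) ≤-refl
    (subst (λ m → Standard (suc (double m)) (suc (double m)) (double j) (suc (double n)))
      -- The witness `suc g ∸ j` completes `j` to half of x - 1; that it does so rests on b < x.
      (m∸n+n≡m (double-cancel-≤ (≤-pred b<x))) (odd-long-even-short j (suc g ∸ j) n))
  ... | inj₂ (j , refl) | inj₂ (n , refl) = few-ones (suc (double j)) (suc (double n)) ≤-refl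
    (subst (λ m → Standard (suc (double (suc m))) (suc (double (suc m))) (suc (double j)) (suc (double n)))
      (m∸n+n≡m (≤-pred (double-cancel-< (≤-pred b<x)))) (odd-long-odd-short j (g ∸ j) n))
  ... | inj₁ (zero , refl) | inj₁ (n , refl) = few-ones 0 (double n) ≤-refl
    (subst (Standard x x 0) (+-identityʳ (double n)) (rooted-resp
      (↭-trans (++⁺ˡ (replicate (double n) (suc x)) (theList-ones x x)) (theList-longs (double n) x x 0 0))
      (even-columns (suc g) (double n))))
  ... | inj₁ (suc j , refl) | inj₁ (n , refl) = few-ones (double (suc j)) (double n) (n≤1+n w)
    (subst (λ m → Standard (suc (double m)) (double m) (double (suc j)) (double n))
      (m∸n+n≡m (double-cancel-≤ (≤-pred b<x))) (even-long-even-short j (g ∸ j) n))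
  ... | inj₂ (zero , refl) | inj₁ (zero , refl) = few-ones 1 0 (n≤1+n w) (rooted (fold w) (end-fold x))
  ... | inj₂ (zero , refl) | inj₁ (suc n , refl) =
    double w , ≤-reflexive (trans (+-comm (double w) 3) (cong suc size)) ,
    ≤-reflexive (trans (+-comm (double w) 2) size) , even-long-one-short g n
    where
    size : suc (suc (double w)) ≡ 2 * x
    size = trans (double≡+ x) (cong (x +_) (sym (+-identityʳ x)))
  ... | inj₂ (suc j , refl) | inj₁ (n , refl) = few-ones (suc (double (suc j))) (double n) (n≤1+n w)
    (subst (λ m → Standard (suc (double m)) (double m) (suc (double (suc j))) (double n))
      (m∸n+n≡m (<⇒≤ (double-cancel-< (≤-pred b<x)))) (even-long-odd-short j (g ∸ j) n))

≤-from-⊓ : ∀ k {A a m n} → A + k ≤ m → A + k ≤ n → (m ∸ k) ⊓ (n ∸ k) ≤ a → A ≤ a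
≤-from-⊓ k {A} A≤m A≤n = ≤-trans (⊓-glb (m+n≤o⇒m≤o∸n A A≤m) (m+n≤o⇒m≤o∸n A A≤n))

columns-list : ∀ x m n → replicate n x ++ replicate m 1 ↭ theList x m n 0
columns-list x m n = ↭-trans (++⁺ˡ (replicate n x) (theList-ones m x))
  (↭-trans (theList-shorts n x m 0 0) (↭-reflexive (cong (λ k → theList x m k 0) (+-identityʳ n))))

long-columns-list : ∀ x m n → replicate n (suc x) ++ replicate m 1 ↭ theList x m 0 n
long-columns-list x m n = ↭-trans (++⁺ˡ (replicate n (suc x)) (theList-ones m x))
  (↭-trans (theList-longs n x m 0 0) (↭-reflexive (cong (theList x m 0) (+-identityʳ n))))

perfect-resp : ∀ {L L'} → L ↭ L' → Perfect L → Perfect L'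
perfect-resp L↭ (perfect (linear c l) e) = perfect (linear c (↭-trans l L↭)) e

capped-resp : ∀ {L L'} → L ↭ L' → Capped L → Capped L'
capped-resp L↭ (capped (linear c l)) = capped (linear c (↭-trans l L↭))

-- The cases with x odd

module _ (g : ℕ) where
  private
    w = double (suc g)
    x = suc w

  odd-case₁ : ∀ a b c → (3 * x ∸ 3) ⊓ (b + 2 * x ∸ 3) ≤ a → Standard x a b c
  odd-case₁ a b c min≤a = subst (λ b → Standard x a b c) (sym b≡)
    (split (b / x) (b % x) (m%n<n b x) (subst (λ b → (3 * x ∸ 3) ⊓ (b + 2 * x ∸ 3) ≤ a) b≡ min≤a))
    where
    b≡ = m≡m%n+[m/n]*n b x
    split : ∀ q r → r < x → (3 * x ∸ 3) ⊓ (r + q * x + 2 * x ∸ 3) ≤ a → Standard x a (r + q * x) c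
    split zero r r<x min≤ with odd-base g r c r<x
    ... | a₀ , a₀+3≤ , a₀+2≤ , S = with-ones x a₀ a (r + 0) c
      (≤-from-⊓ 3
        (≤-trans (≤-reflexive (+-suc a₀ 2)) (≤-trans (s≤s a₀+2≤) (+-monoˡ-≤ (2 * x) {1} {x} (s≤s z≤n))))
        (subst (λ b → a₀ + 3 ≤ b + 2 * x) (sym (+-identityʳ r)) a₀+3≤) min≤)
      (subst (λ b → Standard x a₀ b c) (sym (+-identityʳ r)) S)
    -- The snake takes x - 1 further ones, at most (2x-2) + (x-1) = 3x-3 in total. Here b ≥ x, so
    -- b+2x-3 is at least as large.
    split (suc q) r r<x min≤ with odd-base g r c r<x
    ... | a₀ , a₀+3≤ , a₀+2≤ , S = with-ones x (a₀ + w) a (r + suc q * x) c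
      (≤-from-⊓ 3 enough
        (≤-trans enough (+-monoˡ-≤ (2 * x) (≤-trans (m≤m+n x (q * x)) (m≤n+m (suc q * x) r)))) min≤)
      (subst (Standard x (a₀ + w) (r + suc q * x)) (+-identityʳ c)
        (stack x a₀ r c w (suc q * x) 0 S
          (perfect-resp (columns-list x w (suc q * x)) (snake-perfect (suc g) (suc q)))))
      where
      regroup : ∀ a w → a + w + 3 ≡ suc w + (a + 2)
      regroup = solve-∀
      enough : a₀ + w + 3 ≤ 3 * x
      enough = ≤-trans (≤-reflexive (regroup a₀ w)) (+-monoʳ-≤ x a₀+2≤)

  odd-case₂ : ∀ a b c → 2 * x ∸ 2 ≤ a → 4 * b ≤ 3 * c → Standard x a b c
  odd-case₂ a b c 2x-2≤a 4b≤3c with odd-base g (b % x) (c ∸ b / x * suc x) (m%n<n b x)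
  ... | a₀ , _ , a₀+2≤ , S = subst id
    (cong₂ (Standard x a) (trans (+-comm (b / x * x) (b % x)) (sym (m≡m%n+[m/n]*n b x))) (m+[n∸m]≡n fits))
    (with-zigzags (b / x) x a (b % x) (c ∸ b / x * suc x)
      (with-ones x a₀ a (b % x) (c ∸ b / x * suc x) (≤-trans (m+n≤o⇒m≤o∸n a₀ a₀+2≤) 2x-2≤a) S))
    where
    q = b / x
    -- With g = x - 3 this is q times 3(x+1) + (x-3) = 4x: from x ≥ 3, a zigzag needs at most 4/3 as
    -- many long edges as short ones.
    weigh : ∀ q g → 3 * (q * suc (suc (suc (suc g)))) + q * g ≡ 4 * (q * suc (suc (suc g)))
    weigh = solve-∀
    fits : q * suc x ≤ c
    fits = *-cancelˡ-≤ 3 (begin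
      3 * (q * suc x)                  ≤⟨ m≤m+n _ (q * double g) ⟩
      3 * (q * suc x) + q * double g   ≡⟨ weigh q (double g) ⟩
      4 * (q * x)                      ≤⟨ *-monoʳ-≤ 4 (m/n*n≤m b x) ⟩
      4 * b                            ≤⟨ 4b≤3c ⟩
      3 * c                            ∎)
      where open ≤-Reasoning

-- The cases with x even

module _ (g : ℕ) where
  private
    x = double (suc g)

  -- The remainder `r` of long edges sits in a capped path at the bottom of the stack and costs x
  -- ones.
  even-linear : ∀ a₀ a b c r → a₀ + x ≤ a → r ≤ x → Standard x a₀ b c → Linear x a b (r + c)
  even-linear a₀ a b c r a₀+x≤a r≤x S = subst id
    (trans (cong (λ m → Linear x m (b + 0) (c + r)) (m∸n+n≡m (≤-trans (m≤n+m x a₀) a₀+x≤a)))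
      (cong₂ (Linear x a) (+-identityʳ b) (+-comm c r)))
    (cap x (a ∸ x) b c x 0 r (with-ones x a₀ (a ∸ x) b c (m+n≤o⇒m≤o∸n a₀ a₀+x≤a) S)
      (capped-resp (long-columns-list x x r) (odd-columns (suc g) r r≤x)))

  even-standard : ∀ b → Standard x (suc (double g)) b 0
  even-standard b = rooted-resp (columns-list x (suc (double g)) b) (even-columns g b)

  private
    regroup : ∀ g → suc g + suc (suc g) + 1 ≡ 2 * suc (suc g)
    regroup = solve-∀

    twice : suc (double g) + x + 1 ≤ 2 * x
    twice = ≤-reflexive (regroup (double g))

  even-case₁ : ∀ a b c → (3 * x ∸ 1) ⊓ (c + 2 * x ∸ 1) ≤ a → Linear x a b c
  even-case₁ a b c min≤a = subst (Linear x a b) (sym c≡)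
    (split (c / suc x) (c % suc x) (m%n<n c (suc x))
      (subst (λ c → (3 * x ∸ 1) ⊓ (c + 2 * x ∸ 1) ≤ a) c≡ min≤a))
    where
    c≡ = m≡m%n+[m/n]*n c (suc x)
    split : ∀ q r → r < suc x → (3 * x ∸ 1) ⊓ (r + q * suc x + 2 * x ∸ 1) ≤ a →
      Linear x a b (r + q * suc x)
    -- The columns of length x take x - 1 ones and the remainder takes x, together 2x-1.
    split zero r r< min≤ = even-linear (suc (double g)) a b 0 r
      (≤-from-⊓ 1 (≤-trans twice (m≤n+m (2 * x) x)) (≤-trans twice (m≤n+m (2 * x) (r + 0))) min≤)
      (≤-pred r<) (even-standard b)
    -- The snake adds x ones, giving 3x-1; as c ≥ x+1, the other bound c+2x-1 is no smaller.
    split (suc q) r r< min≤ = even-linear (suc (double g) + x) a b (suc q * suc x) r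
      (≤-from-⊓ 1 thrice
        (≤-trans thrice (+-monoˡ-≤ (2 * x)
          (≤-trans (≤-trans (n≤1+n x) (m≤m+n (suc x) (q * suc x))) (m≤n+m (suc q * suc x) r)))) min≤)
      (≤-pred r<)
      (subst (λ m → Standard x (suc (double g) + x) m (suc q * suc x)) (+-identityʳ b)
        (stack x (suc (double g)) b 0 x 0 (suc q * suc x) (even-standard b)
          (perfect-resp (long-columns-list x x (suc q * suc x)) (snake-perfect (suc g) (suc q)))))
      where
      thrice : suc (double g) + x + x + 1 ≤ 3 * x
      thrice = ≤-trans (≤-reflexive (swap-last (suc (double g) + x) x)) (+-monoʳ-≤ x twice)
        where
        swap-last : ∀ m n → m + n + 1 ≡ n + (m + 1)
        swap-last = solve-∀

  even-case₂ : ∀ a b c → 2 * x ∸ 1 ≤ a → c ≤ b → Linear x a b c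
  even-case₂ a b c 2x-1≤a c≤b = subst id
    (cong₂ (Linear x a) (m+[n∸m]≡n fits)
      (trans (cong (c % suc x +_) (+-identityʳ (q * suc x))) (sym (m≡m%n+[m/n]*n c (suc x)))))
    (even-linear (suc (double g)) a (q * x + (b ∸ q * x)) (q * suc x + 0) (c % suc x)
      (≤-trans (m+n≤o⇒m≤o∸n _ twice) 2x-1≤a) (≤-pred (m%n<n c (suc x)))
      (with-zigzags q x (suc (double g)) (b ∸ q * x) 0 (even-standard (b ∸ q * x))))
    where
    q = c / suc x
    -- A zigzag uses fewer edges of length x than of length x+1, so c ≤ b leaves enough of them.
    fits : q * x ≤ b
    fits = ≤-trans (*-monoʳ-≤ q (n≤1+n x)) (≤-trans (m/n*n≤m c (suc x)) c≤b)

-- From differences back to lengths in K_v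

length-steps : ∀ y p → length (steps (y ∷ p)) ≡ length p
length-steps y []      = refl
length-steps y (z ∷ p) = cong suc (length-steps z p)

-- A difference d ≤ v/2 satisfies d ≤ v - d, so the minimum in `edgeLength` is d itself.
pathLengths≡steps : ∀ v p → All (_≤ v / 2) (steps p) → pathLengths v p ≡ steps p
pathLengths≡steps v []          _          = refl
pathLengths≡steps v (y ∷ [])    _          = refl
pathLengths≡steps v (y ∷ z ∷ p) (d≤ ∷ ds≤) = cong₂ _∷_
  (m≤n⇒m⊓n≡m (m+n≤o⇒m≤o∸n _ (≤-trans (≤-reflexive (twice ∣ y - z ∣))
    (≤-trans (*-monoˡ-≤ 2 d≤) (m/n*n≤m v 2)))))
  (pathLengths≡steps v (z ∷ p) ds≤)
  where
  twice : ∀ d → d + d ≡ d * 2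
  twice = solve-∀

linear⇒hamiltonian : ∀ x a b c → Admissible (a + b + c + 1) (theList x a b c) → Linear x a b c →
  HasHamPathWith (a + b + c + 1) (theList x a b c)
linear⇒hamiltonian x a b c (size , bounds , _) (line {v} {y} {p} (linear covers lengths)) =
  y ∷ p ,
  ↭-trans covers (↭-trans (↭-reflexive (trans (cong downFrom v≡) (sym (reverse-upTo _)))) (↭-reverse _)) ,
  ↭-trans (↭-reflexive (pathLengths≡steps _ (y ∷ p)
    (All-resp-↭ (↭-sym lengths) (All.map proj₂ bounds)))) lengths
  where
  -- The order is recovered by counting: a path has one vertex more than it has edges, and
  -- admissibility fixes the number of edges.
  v≡ : v ≡ a + b + c + 1
  v≡ = trans (sym (trans (↭-length covers) (length-downFrom v)))
    (trans (cong suc (trans (sym (length-steps y p)) (trans (↭-length lengths) (trans size (m+n∸n≡m _ 1)))))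
      (+-comm 1 (a + b + c)))

odd-shape : ∀ x → 3 ≤ x → IsOdd x → ∃ λ g → x ≡ suc (double (suc g))
odd-shape x 3≤x odd with parity x | 3≤x
... | inj₂ (suc g , refl) | _      = g , refl
... | inj₂ (zero , refl)  | s≤s ()
... | inj₁ (h , refl)     | _      = contradiction
  (trans (sym (m*n%n≡0 h 2)) (trans (cong (_% 2) (sym (double≡*2 h))) odd)) λ ()

even-shape : ∀ x → 3 ≤ x → IsEven x → ∃ λ g → x ≡ double (suc g)
even-shape x 3≤x even with parity x | 3≤x
... | inj₁ (suc g , refl) | _  = g , refl
... | inj₁ (zero , refl)  | ()
... | inj₂ (h , refl)     | _  = contradiction
  (trans (sym ([m+kn]%n≡m%n 1 h 2)) (trans (cong (λ m → suc m % 2) (sym (double≡*2 h))) even)) λ ()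

theorem1p6 : (x a b c : ℕ) → 3 ≤ x →
    Admissible (a + b + c + 1) (theList x a b c) →
    ((IsOdd x × ((3 * x ∸ 3) ⊓ (b + 2 * x ∸ 3)) ≤ a)
    ⊎ (IsOdd x × (2 * x ∸ 2 ≤ a) × (4 * b ≤ 3 * c))
    ⊎ (IsEven x × ((3 * x ∸ 1) ⊓ (c + 2 * x ∸ 1)) ≤ a)
    ⊎ (IsEven x × (2 * x ∸ 1 ≤ a) × (c ≤ b))) →
    HasHamPathWith (a + b + c + 1) (theList x a b c)
theorem1p6 x a b c 3≤x adm cases = linear⇒hamiltonian x a b c adm (realize cases)
  where
  realize : _ → Linear x a b c
  realize (inj₁ (odd , min≤a)) with odd-shape x 3≤x odd
  ... | g , refl = standard⇒linear (odd-case₁ g a b c min≤a)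
  realize (inj₂ (inj₁ (odd , 2x-2≤a , 4b≤3c))) with odd-shape x 3≤x odd
  ... | g , refl = standard⇒linear (odd-case₂ g a b c 2x-2≤a 4b≤3c)
  realize (inj₂ (inj₂ (inj₁ (even , min≤a)))) with even-shape x 3≤x even
  ... | g , refl = even-case₁ g a b c min≤a
  realize (inj₂ (inj₂ (inj₂ (even , 2x-1≤a , c≤b)))) with even-shape x 3≤x even
  ... | g , refl = even-case₂ g a b c 2x-1≤a c≤b
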